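{- Let $G$ be a finite simple graph and let $v$ be a vertex of $G$. Then \[ Y_G = Y_{G-v} + (Y_v-1)\,Y_{G-N[v]} + \sum_{\alpha}X_G^{\alpha}, \] where $\alpha$ ranges over all maps from $V(G)$ to $\mathbb{N}$ such that $\alpha(v)\ge 1$ and $\alpha(u)\ge 1$ for some $u\in N(v)$.
   Context: $\mathbb{N}=\{0,1,2,\ldots\}$. $N(v)$ is the set of neighbors of $v$, $N[v]=\{v\}\cup N(v)$, and $G-v$, $G-N[v]$ are the graphs obtained from $G$ by deleting the vertex $v$, respectively all vertices of $N[v]$. $Y_v$ denotes $Y_H$ for $H$ the graph with the single vertex $v$. Let $\mathbf{x}=\{x_1,x_2,\ldots\}$ be indeterminates. For a finite simple graph $G$ and $\alpha:V(G)\to\mathbb{N}$, a multicoloring of $G$ of type $\alpha$ is a map $\kappa$ assigning to each vertex $w$ a finite set $\kappa(w)$ of positive integers with $|\kappa(w)|=\alpha(w)$; it is proper if $\kappa(w)\cap\kappa(w')=\emptyset$ for every edge $ww'$. Define $X_G^\alpha=\sum_\kappa x_1^{a_1}x_2^{a_2}\cdots$, summed over all proper multicolorings $\kappa$ of type $\alpha$, where $a_i$ is the number of vertices $w$ with $i\in\kappa(w)$. Define the formal power series $Y_G=\sum_{\alpha:V(G)\to\mathbb{N}}X_G^\alpha$ (for the graph with no vertices, $Y=1$). -}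

module Defs where

open import Data.Bool using (true; false; if_then_else_)
open import Data.Empty using (⊥)
open import Data.Fin using (Fin)
open import Data.Fin.Properties using (all?; any?)
open import Data.Fin.Subset using (Subset; _∈_; ∣_∣; _∩_; Empty; ⁅_⁆; _∪_)
open import Data.Fin.Subset.Properties using (_∈?_; nonempty?; ∣p∣≤n)
open import Data.Integer as ℤ using (ℤ; +_; 0ℤ; 1ℤ)
open import Data.List as List
  using (List; []; _∷_; foldr; map; filter; length; upTo; allFin; cartesianProductWith)
open import Data.List.Membership.Propositional using () renaming (_∈_ to _∈ˡ_)
open import Data.List.Membership.Propositional.Properties
  using (∈-upTo⁺; ∈-cartesianProductWith⁺)
open import Data.List.Relation.Unary.All using ([])
open import Data.List.Relation.Unary.Any using (here)
open import Data.List.Relation.Unary.AllPairs using ([]; _∷_)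
open import Data.List.Relation.Unary.Unique.Propositional using (Unique)
open import Data.List.Relation.Unary.Unique.Propositional.Properties
  using (upTo⁺; cartesianProductWith⁺)
open import Data.Nat as ℕ using (ℕ; zero; suc; _∸_; _≤_; s≤s)
open import Data.Nat.Properties using (_≟_; _≤?_)
open import Data.Product using (_×_; _,_; ∃)
open import Data.Vec as Vec using (Vec; []; _∷_; lookup; replicate; tabulate; count)
open import Data.Vec.Properties using (≡-dec; ∷-injective)
open import Level using (0ℓ)
open import Relation.Binary using (Rel; Symmetric; Irreflexive) renaming (Decidable to Decidable₂)
open import Relation.Binary.PropositionalEquality using (_≡_; _≢_; refl; subst)
open import Relation.Nullary using (does; yes; no; contradiction)
open import Relation.Nullary.Decidable using (¬?; _×-dec_; _→-dec_)
open import Relation.Unary using (Pred; Decidable)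
open import Relation.Unary.Properties using (U?)

-- A formal power series in x₁, x₂, … over ℤ.  A monomial involves finitely many
-- variables; coeff a, for a = a₁ ∷ … ∷ aₖ ∷ [], is the coefficient of x₁^a₁ ⋯ xₖ^aₖ.  (Equivalently, the restriction of coeff to
-- length k is the image of the series in ℤ[[x₁,…,xₖ]] under xₖ₊₁ = xₖ₊₂ = ⋯ = 0.)
-- Appending zeros to a does not change the monomial; every operation below is
-- compatible with that identification.
record Series : Set where
  field
    coeff : ∀ {k} → Vec ℕ k → ℤ

open Series public

infix  4 _≈_
infixl 6 _⊕_ _⊖_
infixl 7 _⊛_

_≈_ : Rel Series 0ℓ
f ≈ g = ∀ {k} (a : Vec ℕ k) → coeff f a ≡ coeff g a

sumℤ : List ℤ → ℤ
sumℤ = foldr ℤ._+_ 0ℤ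

-- All pairs (b , c) of exponent vectors with b + c = a, each exactly once.
splits : ∀ {k} → Vec ℕ k → List (Vec ℕ k × Vec ℕ k)
splits []       = ([] , []) ∷ []
splits (a ∷ as) =
  cartesianProductWith (λ i (b , c) → (i ∷ b) , ((a ∸ i) ∷ c)) (upTo (suc a)) (splits as)

𝟙 : Series
𝟙 .coeff a = if does (≡-dec _≟_ a (replicate _ 0)) then 1ℤ else 0ℤ

_⊕_ _⊖_ _⊛_ : Series → Series → Series
(f ⊕ g) .coeff a = coeff f a ℤ.+ coeff g a
(f ⊖ g) .coeff a = coeff f a ℤ.- coeff g a
(f ⊛ g) .coeff a = sumℤ (map (λ (b , c) → coeff f b ℤ.* coeff g c) (splits a))

-- A family can be summed formally when every monomial occurs in only finitely many
-- of its members.  The support may be larger than necessary: since it has no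
-- repetitions and misses only zero coefficients, the sum does not depend on it.
record Summable {I : Set} (f : I → Series) : Set where
  field
    support  : ∀ {k} → Vec ℕ k → List I
    unique   : ∀ {k} (a : Vec ℕ k) → Unique (support a)
    complete : ∀ {k} (a : Vec ℕ k) i → coeff (f i) a ≢ 0ℤ → i ∈ˡ support a

open Summable public

-- The formal sum of f i over all i satisfying P.
∑[_]_by_ : {I : Set} {P : Pred I 0ℓ} → Decidable P → (f : I → Series) → Summable f → Series
(∑[ P? ] f by s) .coeff a = sumℤ (map (λ i → coeff (f i) a) (filter P? (support s a)))

record Graph : Set₁ where
  field
    order  : ℕ
    Adj    : Rel (Fin order) 0ℓ
    adj?   : Decidable₂ Adj
    symm   : Symmetric Adj
    irrefl : Irreflexive _≡_ Adj

  Vertex : Set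
  Vertex = Fin order

open Graph public

N : (G : Graph) → Vertex G → Subset (order G)
N G v = tabulate (λ u → does (adj? G v u))

N[_,_] : (G : Graph) → Vertex G → Subset (order G)
N[ G , v ] = ⁅ v ⁆ ∪ N G v

single : Graph
single = record
  { order  = 1
  ; Adj    = λ _ _ → ⊥
  ; adj?   = λ _ _ → no λ ()
  ; symm   = λ ()
  ; irrefl = λ _ ()
  }

-- The vertices outside S, in increasing order.
kept : (G : Graph) → Subset (order G) → List (Vertex G)
kept G S = filter (λ u → ¬? (u ∈? S)) (allFin (order G))

infixl 8 _∖_

-- The subgraph induced on the vertices outside S; vertex i of it is the i-th
-- element of kept G S.
_∖_ : (G : Graph) → Subset (order G) → Graph
G ∖ S = record
  { order  = length (kept G S)
  ; Adj    = λ i j → Adj G (vertex i) (vertex j)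
  ; adj?   = λ i j → adj? G (vertex i) (vertex j)
  ; symm   = symm G
  ; irrefl = λ { refl → irrefl G refl }
  }
  where
  vertex : Fin (length (kept G S)) → Vertex G
  vertex = List.lookup (kept G S)

-- A map V(G) → ℕ, as the vector of its values.
Type : Graph → Set
Type G = Vec ℕ (order G)

-- An assignment of a set of colors from {1,…,k} to each vertex.  These are the only
-- ones that can contribute to a monomial in x₁,…,xₖ.
Coloring : Graph → ℕ → Set
Coloring G k = Vec (Subset k) (order G)

module _ (G : Graph) {k : ℕ} where

  HasType : Type G → Coloring G k → Set
  HasType α κ = ∀ w → ∣ lookup κ w ∣ ≡ lookup α w

  Proper : Coloring G k → Set
  Proper κ = ∀ w w′ → Adj G w w′ → Empty (lookup κ w ∩ lookup κ w′)

  -- The exponent vector: its i-th entry is the number of vertices w with i ∈ κ(w).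
  content : Coloring G k → Vec ℕ k
  content κ = tabulate (λ i → count (i ∈?_) κ)

  Contributes : Type G → Vec ℕ k → Coloring G k → Set
  Contributes α a κ = HasType α κ × Proper κ × content κ ≡ a

  contributes? : ∀ α a → Decidable (Contributes α a)
  contributes? α a κ =
    all? (λ w → ∣ lookup κ w ∣ ≟ lookup α w)
    ×-dec all? (λ w → all? λ w′ → adj? G w w′ →-dec ¬? (nonempty? _))
    ×-dec ≡-dec _≟_ (content κ) a

vectors : {A : Set} → List A → ∀ n → List (Vec A n)
vectors xs zero    = [] ∷ []
vectors xs (suc n) = cartesianProductWith _∷_ xs (vectors xs n)

colorings : (G : Graph) (k : ℕ) → List (Coloring G k)
colorings G k = vectors (vectors (true ∷ false ∷ []) k) (order G)

-- The coefficient of x^a counts the proper multicolorings of type α with content a.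
X : (G : Graph) → Type G → Series
X G α .coeff {k} a = + length (filter (contributes? G α a) (colorings G k))

vectors-unique : {A : Set} {xs : List A} → Unique xs → ∀ n → Unique (vectors xs n)
vectors-unique u zero    = [] ∷ []
vectors-unique u (suc n) = cartesianProductWith⁺ _∷_ ∷-injective u (vectors-unique u n)

∈-vectors : {A : Set} {xs : List A} → ∀ {n} (v : Vec A n) →
            (∀ i → lookup v i ∈ˡ xs) → v ∈ˡ vectors xs n
∈-vectors []      _ = here refl
∈-vectors (x ∷ v) h =
  ∈-cartesianProductWith⁺ _∷_ (h Fin.zero) (∈-vectors v (λ i → h (Fin.suc i)))

filter-nonempty : {A : Set} {P : Pred A 0ℓ} (P? : Decidable P) (xs : List A) →
                  + length (filter P? xs) ≢ 0ℤ → ∃ P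
filter-nonempty P? []       h = contradiction refl h
filter-nonempty P? (x ∷ xs) h with P? x
... | yes p = x , p
... | no  _ = filter-nonempty P? xs h

-- A subset of {1,…,k} has at most k elements, so only types with all values at most k
-- contribute to a monomial in x₁,…,xₖ.
X-summable : ∀ G → Summable (X G)
X-summable G .support {k} _ = vectors (upTo (suc k)) (order G)
X-summable G .unique  {k} _ = vectors-unique (upTo⁺ (suc k)) (order G)
X-summable G .complete {k} a α h
  with κ , type , _ ← filter-nonempty (contributes? G α a) (colorings G k) h =
  ∈-vectors α λ w → ∈-upTo⁺ (s≤s (subst (_≤ k) (type w) (∣p∣≤n (lookup κ w))))

Y : Graph → Series
Y G = ∑[ U? ] X G by X-summable G

PositiveAtAndNear : (G : Graph) → Vertex G → Type G → Set
PositiveAtAndNear G v α = 1 ≤ lookup α v × ∃ λ u → u ∈ N G v × 1 ≤ lookup α u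

positiveAtAndNear? : ∀ G v → Decidable (PositiveAtAndNear G v)
positiveAtAndNear? G v α =
  (1 ≤? lookup α v) ×-dec any? (λ u → (u ∈? N G v) ×-dec (1 ≤? lookup α u))

module Submission where

-- Every coefficient is the number of elements of a finite set.  In Y G it counts the proper
-- colorings of G with the given content, since each coloring has exactly one type.  These fall
-- into three classes: v is uncolored; v is colored but none of its neighbors is; v and some
-- neighbor are colored.  Restriction turns the first class into the colorings of G − v, and the
-- second into pairs of a nonempty color set for v and a coloring of G − N[v].

open import Data.Bool as Bool using (true; false)
open import Data.Fin as Fin using (Fin; zero; suc)
open import Data.Fin.Properties as Fin using (suc-injective)
open import Data.Fin.Subset
  using (Subset; _∈_; _∉_; ∣_∣; ⁅_⁆; Empty; ⊥; outside; _∩_)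
open import Data.Fin.Subset.Properties
  using (_∈?_; ∉⊥; ∣p∣≤n; ∣⊥∣≡0; x∈⁅x⁆; x∈⁅y⁆⇒x≡y; x∈p∩q⁺; x∈p∩q⁻; x∈p∪q⁺; x∈p∪q⁻)
open import Data.Integer as ℤ using (ℤ; +_; 0ℤ; 1ℤ)
import Data.Integer.Properties as ℤ
open import Data.List as List
  using (List; []; _∷_; _++_; map; filter; length; cartesianProduct; upTo)
open import Data.List.Membership.Propositional using () renaming (_∈_ to _∈ˡ_)
open import Data.List.Membership.Propositional.Properties
open import Data.List.Membership.Propositional.Properties.WithK using (unique∧set⇒bag)
open import Data.List.Properties using (length-++; length-map)
open import Data.List.Relation.Binary.BagAndSetEquality using (∼bag⇒↭)
open import Data.List.Relation.Binary.Permutation.Propositional.Properties using (↭-length)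
open import Data.List.Relation.Unary.All as All using ([]; _∷_)
import Data.List.Relation.Unary.All.Properties as All
open import Data.List.Relation.Unary.AllPairs using ([]; _∷_)
open import Data.List.Relation.Unary.Any as Any using (here; there)
open import Data.List.Relation.Unary.Any.Properties using (lookup-index)
open import Data.List.Relation.Unary.Unique.Propositional using (Unique)
open import Data.List.Relation.Unary.Unique.Propositional.Properties
open import Data.Nat as ℕ using (ℕ; _+_; _*_; _≤_; s≤s)
import Data.Nat.Properties as ℕ
open import Data.Product using (_×_; _,_; proj₁; proj₂; ∃)
open import Data.Sum as Sum using (_⊎_; inj₁; inj₂; [_,_]′)
open import Data.Unit using (tt)
open import Data.Vec as Vec using (Vec; []; _∷_; lookup; count; zipWith; tabulate; replicate)
open import Data.Vec.Properties
  using (≡-dec; ∷-injectiveˡ; ∷-injectiveʳ; lookup-map; lookup-replicate; lookup-zipWith;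
         lookup∘tabulate; tabulate∘lookup; tabulate-cong; zipWith-identityˡ; []=⇒lookup; lookup⇒[]=)
open import Defs
open import Function using (_∘_; id; mk⇔)
open import Level using (0ℓ)
open import Relation.Binary.PropositionalEquality
  using (_≡_; _≢_; refl; sym; trans; cong; cong₂; subst; subst₂; module ≡-Reasoning)
open import Relation.Nullary using (¬_; yes; no; does; contradiction)
open import Relation.Nullary.Decidable using (¬?; _×-dec_; dec-true; decidable-stable)
open import Relation.Unary using (Pred; Decidable)
open import Relation.Unary.Properties using (U?)

-- Counting finite predicates: uniqueness of the count, bijections, sums, products, differences.

private
  variable
    A B   : Set
    P Q R : Pred A 0ℓ
    z w   : ℤ
    k n   : ℕ
    a     : Vec ℕ k

-- z is the number of elements satisfying P; an integer, so that it can be a coefficient.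
record Card {A : Set} (P : Pred A 0ℓ) (z : ℤ) : Set where
  field
    elements  : List A
    distinct  : Unique elements
    sound     : ∀ {x} → x ∈ˡ elements → P x
    exhausted : ∀ {x} → P x → x ∈ˡ elements
    size      : z ≡ + length elements

open Card

-- Two duplicate-free lists with the same members are permutations of each other, so their lengths
-- agree. Every equality of coefficients below comes from counting one predicate in two ways.
card-unique : Card P z → Card P w → z ≡ w
card-unique c d = begin
  _                     ≡⟨ size c ⟩
  + length (elements c) ≡⟨ cong +_ (↭-length (∼bag⇒↭ (unique∧set⇒bag (distinct c) (distinct d)
                             (mk⇔ (exhausted d ∘ sound c) (exhausted c ∘ sound d))))) ⟩
  + length (elements d) ≡⟨ size d ⟨
  _                     ∎
  where open ≡-Reasoning

-- Injectivity is asked for on the members of `xs` alone, because a map such as `proj₂` becomes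
-- injective only on the set being counted.
map-unique : (f : A → B) {xs : List A} →
             (∀ {x y} → x ∈ˡ xs → y ∈ˡ xs → f x ≡ f y → x ≡ y) →
             Unique xs → Unique (map f xs)
map-unique f inj []       = []
map-unique f inj (x∉ ∷ u) =
  All.map⁺ (All.tabulate λ y∈ eq → All.lookup x∉ y∈ (inj (here refl) (there y∈) eq))
  ∷ map-unique f (λ x∈ y∈ → inj (there x∈) (there y∈)) u

card-image : (f : A → B) →
             (∀ {x} → P x → Q (f x)) → (∀ {y} → Q y → ∃ λ x → P x × f x ≡ y) →
             (∀ {x y} → P x → P y → f x ≡ f y → x ≡ y) →
             Card P z → Card Q z
card-image {Q = Q} f to onto inj c = record
  { elements  = map f (elements c)
  ; distinct  = map-unique f (λ x∈ y∈ → inj (sound c x∈) (sound c y∈)) (distinct c)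
  ; sound     = λ y∈ → let x , x∈ , y≡ = ∈-map⁻ f y∈ in subst Q (sym y≡) (to (sound c x∈))
  ; exhausted = λ q → let x , p , fx≡ = onto q in subst (_∈ˡ _) fx≡ (∈-map⁺ f (exhausted c p))
  ; size      = trans (size c) (cong +_ (sym (length-map f (elements c))))
  }

card-map : (f : A → B) (g : B → A) →
           (∀ {x} → P x → Q (f x)) → (∀ {y} → Q y → P (g y)) →
           (∀ {x} → P x → g (f x) ≡ x) → (∀ {y} → Q y → f (g y) ≡ y) →
           Card P z → Card Q z
card-map f g to from gf fg = card-image f to (λ q → g _ , from q , fg q)
  (λ p p′ eq → trans (sym (gf p)) (trans (cong g eq) (gf p′)))

card-⇔ : (∀ {x} → P x → Q x) → (∀ {x} → Q x → P x) → Card P z → Card Q z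
card-⇔ to from = card-map id id to from (λ _ → refl) (λ _ → refl)

card-⊎ : (∀ {x} → P x → R x) → (∀ {x} → Q x → R x) → (∀ {x} → R x → P x ⊎ Q x) →
         (∀ {x} → P x → ¬ Q x) → Card P z → Card Q w → Card R (z ℤ.+ w)
card-⊎ p q r disjoint c d = record
  { elements  = elements c ++ elements d
  ; distinct  = ++⁺ (distinct c) (distinct d)
                  λ (x∈c , x∈d) → disjoint (sound c x∈c) (sound d x∈d)
  ; sound     = [ p ∘ sound c , q ∘ sound d ]′ ∘ ∈-++⁻ (elements c)
  ; exhausted = [ ∈-++⁺ˡ ∘ exhausted c , ∈-++⁺ʳ (elements c) ∘ exhausted d ]′ ∘ r
  ; size      = trans (cong₂ ℤ._+_ (size c) (size d))
                      (cong +_ (sym (length-++ (elements c))))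
  }

card-⊥ : (∀ {x} → ¬ P x) → Card P 0ℤ
card-⊥ ¬p = record
  { elements = [] ; distinct = [] ; sound = λ () ; exhausted = λ p → contradiction p ¬p
  ; size = refl }

card-singleton : (x : A) → P x → (∀ {y} → P y → y ≡ x) → Card P 1ℤ
card-singleton {P = P} x p only = record
  { elements = x ∷ [] ; distinct = [] ∷ []
  ; sound = λ { (here y≡x) → subst P (sym y≡x) p } ; exhausted = here ∘ only ; size = refl }

card-× : Card P z → Card Q w → Card (λ (x , y) → P x × Q y) (z ℤ.* w)
card-× c d = record
  { elements  = cartesianProduct (elements c) (elements d)
  ; distinct  = cartesianProduct⁺ (distinct c) (distinct d)
  ; sound     = λ xy∈ → let x∈ , y∈ = ∈-cartesianProduct⁻ (elements c) (elements d) xy∈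
                        in sound c x∈ , sound d y∈
  ; exhausted = λ (p , q) → ∈-cartesianProduct⁺ (exhausted c p) (exhausted d q)
  ; size      = begin
      _                                                 ≡⟨ cong₂ ℤ._*_ (size c) (size d) ⟩
      + length (elements c) ℤ.* + length (elements d)   ≡⟨ ℤ.pos-* (length (elements c)) _ ⟨
      + (length (elements c) * length (elements d))
        ≡⟨ cong +_ (length-cartesianProduct (elements c)) ⟨
      + length (cartesianProduct (elements c) (elements d)) ∎
  }
  where
  open ≡-Reasoning
  length-cartesianProduct : (xs : List A) {ys : List B} →
                            length (cartesianProduct xs ys) ≡ length xs * length ys
  length-cartesianProduct []       = refl
  length-cartesianProduct (x ∷ xs) {ys} =
    trans (length-++ (map (x ,_) ys))
          (cong₂ _+_ (length-map (x ,_) ys) (length-cartesianProduct xs))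

-- A sum of counts is the count of a disjoint union of fibres; `Unique is` keeps a fibre from being
-- counted twice. Formal sums of series and convolutions are both read this way.
card-Σ : {I : Set} {is : List I} {F : I → Pred A 0ℓ} {f : I → ℤ} → Unique is →
         (∀ i → Card (F i) (f i)) →
         Card {I × A} (λ ix → proj₁ ix ∈ˡ is × F (proj₁ ix) (proj₂ ix)) (sumℤ (map f is))
card-Σ {is = []} [] c = card-⊥ λ ()
card-Σ {is = i ∷ is} {F = F} (i∉ ∷ u) c =
  card-⊎ {P = λ jx → proj₁ jx ≡ i × F i (proj₂ jx)}
         (λ { (refl , p) → here refl , p }) (λ (i∈ , p) → there i∈ , p)
         (λ { (here refl , p) → inj₁ (refl , p) ; (there i∈ , p) → inj₂ (i∈ , p) })
         (λ { (refl , _) (i∈ , _) → All.lookup i∉ i∈ refl })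
         (card-map (i ,_) proj₂ (refl ,_) proj₂
                   (λ _ → refl) (λ { (refl , _) → refl }) (c i))
         (card-Σ u c)

card-filter : {xs : List A} (P? : Decidable P) → Unique xs → (∀ {x} → P x → x ∈ˡ xs) →
              Card P (+ length (filter P? xs))
card-filter {xs = xs} P? u p∈ = record
  { elements  = filter P? xs
  ; distinct  = filter⁺ P? u
  ; sound     = proj₂ ∘ ∈-filter⁻ P? {xs = xs}
  ; exhausted = λ p → ∈-filter⁺ P? (p∈ p) p
  ; size      = refl
  }

-- This gives the difference in `Y single ⊖ 𝟙` a meaning as a count.
card-∖ : Decidable Q → (∀ {x} → Q x → P x) → Card P z → Card Q w →
         Card (λ x → P x × ¬ Q x) (z ℤ.- w)
card-∖ {Q = Q} {P = P} {z = z} {w = w} Q? q⇒p c d = subst (Card _) (sym z−w≡) c∖d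
  where
  rest = filter (λ x → ¬? (Q? x)) (elements c)
  c∖d : Card (λ x → P x × ¬ Q x) (+ length rest)
  c∖d = record
    { elements  = rest
    ; distinct  = filter⁺ _ (distinct c)
    ; sound     = λ x∈ → let x∈c , ¬q = ∈-filter⁻ _ {xs = elements c} x∈ in sound c x∈c , ¬q
    ; exhausted = λ (p , ¬q) → ∈-filter⁺ _ (exhausted c p) ¬q
    ; size      = refl
    }
  split : ∀ {x} → P x → (P x × ¬ Q x) ⊎ Q x
  split {x} p with Q? x
  ... | yes q = inj₂ q
  ... | no ¬q = inj₁ (p , ¬q)
  z−w≡ : z ℤ.- w ≡ + length rest
  z−w≡ = begin
    z ℤ.- w
      -- `P` is counted a second time, as the disjoint union of `rest` and `Q`, which gives `z` as
      -- `+ length rest ℤ.+ w`.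
      ≡⟨ cong (ℤ._- w) (card-unique c (card-⊎ proj₁ q⇒p split proj₂ c∖d d)) ⟩
    + length rest ℤ.+ w ℤ.- w     ≡⟨ ℤ.+-assoc (+ length rest) w (ℤ.- w) ⟩
    + length rest ℤ.+ (w ℤ.- w)   ≡⟨ cong (λ x → + length rest ℤ.+ x) (ℤ.+-inverseʳ w) ⟩
    + length rest ℤ.+ 0ℤ          ≡⟨ ℤ.+-identityʳ _ ⟩
    + length rest                 ∎
    where open ≡-Reasoning

-- Entries of `content` are values of `count` along a vector. Reading them as numbers of vertices
-- lets contents on different graphs be compared by bijections of vertices.
card-count : (P? : Decidable P) {n : ℕ} (xs : Vec A n) →
             Card (P ∘ lookup xs) (+ count P? xs)
card-count P? []       = card-⊥ λ { {()} }
card-count {P = P} P? (x ∷ xs) with P? x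
... | yes p = card-⊎
  {P = _≡ zero} {Q = λ j → ∃ λ i → j ≡ suc i × P (lookup xs i)}
  (λ { refl → p }) (λ { (_ , refl , q) → q })
  (λ { {zero} _ → inj₁ refl ; {suc j} q → inj₂ (j , refl , q) }) (λ { refl () })
  (card-singleton zero refl id)
  (card-image suc (λ q → _ , refl , q) (λ { (j , refl , q) → j , q , refl })
    (λ _ _ → suc-injective) (card-count P? xs))
... | no ¬p = card-image suc id
  (λ { {zero} p → contradiction p ¬p ; {suc j} q → j , q , refl })
  (λ _ _ → suc-injective) (card-count P? xs)

lookup-ext : {xs ys : Vec A n} → (∀ i → lookup xs i ≡ lookup ys i) → xs ≡ ys
lookup-ext {xs = xs} {ys = ys} eq = begin
  xs                    ≡⟨ tabulate∘lookup xs ⟨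
  tabulate (lookup xs)  ≡⟨ tabulate-cong eq ⟩
  tabulate (lookup ys)  ≡⟨ tabulate∘lookup ys ⟩
  ys                    ∎
  where open ≡-Reasoning

-- Coefficients of a product of series.

splits-unique : (a : Vec ℕ k) → Unique (splits a)
splits-unique []       = [] ∷ []
splits-unique (a ∷ as) = cartesianProductWith⁺ _
  (λ eq → let eqb = cong proj₁ eq ; eqc = cong proj₂ eq
          in ∷-injectiveˡ eqb , cong₂ _,_ (∷-injectiveʳ eqb) (∷-injectiveʳ eqc))
  (upTo⁺ (ℕ.suc a)) (splits-unique as)

∈-splits⁺ : (b c : Vec ℕ k) → (b , c) ∈ˡ splits (zipWith _+_ b c)
∈-splits⁺ []       []       = here refl
∈-splits⁺ (x ∷ b) (y ∷ c) =
  -- The second head listed by `splits` is `x + y ∸ x`, not literally `y`.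
  subst (λ d → (x ∷ b , d ∷ c) ∈ˡ splits (zipWith _+_ (x ∷ b) (y ∷ c))) (ℕ.m+n∸m≡n x y)
    (∈-cartesianProductWith⁺ _ (∈-upTo⁺ (s≤s (ℕ.m≤m+n x y))) (∈-splits⁺ b c))

∈-splits⁻ : (a : Vec ℕ k) {b c : Vec ℕ k} → (b , c) ∈ˡ splits a → zipWith _+_ b c ≡ a
∈-splits⁻ []       (here refl) = refl
∈-splits⁻ (a ∷ as) bc∈
  with _ , _ , i∈ , bc∈′ , refl ← ∈-cartesianProductWith⁻ _ (upTo (ℕ.suc a)) (splits as) bc∈ =
  -- Membership in `upTo (suc a)` bounds the first head by `a`, so the truncated subtraction is
  -- exact.
  cong₂ _∷_ (ℕ.m+[n∸m]≡n (ℕ.s≤s⁻¹ (∈-upTo⁻ i∈))) (∈-splits⁻ as bc∈′)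

-- A pair `(x , y)` determines its split as `(s x , t y)`. Hence forgetting the split is a bijection
-- from the triples counted by the convolution to the pairs with total weight `a`.
card-⊛ : {f g : Series} (s : A → Vec ℕ k) (t : B → Vec ℕ k) →
         (∀ b → Card (λ x → P x × s x ≡ b) (coeff f b)) →
         (∀ c → Card (λ y → Q y × t y ≡ c) (coeff g c)) →
         Card {A × B}
              (λ xy → (P (proj₁ xy) × Q (proj₂ xy)) × zipWith _+_ (s (proj₁ xy)) (t (proj₂ xy)) ≡ a)
              (coeff (f ⊛ g) a)
card-⊛ {a = a} {f = f} {g} s t cf cg = card-map
  proj₂ (λ (x , y) → (s x , t y) , (x , y))
  (λ { (bc∈ , (p , refl) , (q , refl)) → (p , q) , ∈-splits⁻ a bc∈ })
  (λ { ((p , q) , refl) → ∈-splits⁺ _ _ , (p , refl) , (q , refl) })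
  (λ { (_ , (_ , refl) , (_ , refl)) → refl })
  (λ _ → refl)
  (card-Σ (splits-unique a) λ (b , c) → card-× (cf b) (cg c))

-- The series of the theorem as counts of colorings.

typeOf : Vec (Subset k) n → Vec ℕ n
typeOf = Vec.map ∣_∣

ProperWith : (G : Graph) → Vec ℕ k → Pred (Coloring G k) 0ℓ
ProperWith G a κ = Proper G κ × content G κ ≡ a

∈-colorings : (G : Graph) (κ : Coloring G k) → κ ∈ˡ colorings G k
∈-colorings G κ = ∈-vectors κ λ w → ∈-vectors (lookup κ w) λ i → ∈-sides (lookup (lookup κ w) i)
  where
  ∈-sides : ∀ b → b ∈ˡ true ∷ false ∷ []
  ∈-sides true  = here refl
  ∈-sides false = there (here refl)

colorings-unique : (G : Graph) (k : ℕ) → Unique (colorings G k)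
colorings-unique G k =
  vectors-unique (vectors-unique (((λ ()) ∷ []) ∷ [] ∷ []) k) (order G)

∑X-card : (G : Graph) {P : Pred (Type G) 0ℓ} (P? : Decidable P) (a : Vec ℕ k) →
          Card (λ κ → ProperWith G a κ × P (typeOf κ)) (coeff (∑[ P? ] X G by X-summable G) a)
∑X-card {k = k} G {P} P? a = card-map
  proj₂ (λ κ → typeOf κ , κ)
  (λ { {α , κ} (α∈ , type , pc) → pc ,
       subst P (sym (typeOf≡ type)) (proj₂ (∈-filter⁻ P? {xs = types} α∈)) })
  (λ { {κ} (pc , p) → ∈-filter⁺ P? (∈types κ) p , (λ w → sym (lookup-map w ∣_∣ κ)) , pc })
  (λ { {α , κ} (_ , type , _) → cong (_, κ) (typeOf≡ type) })
  (λ _ → refl)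
  (card-Σ (filter⁺ P? (unique (X-summable G) a)) λ α →
    card-filter (contributes? G α a) (colorings-unique G k) λ {κ} _ → ∈-colorings G κ)
  where
  types = support (X-summable G) a
  ∈types : ∀ κ → typeOf κ ∈ˡ types
  ∈types κ = ∈-vectors (typeOf κ) λ w →
    ∈-upTo⁺ (s≤s (subst (_≤ k) (sym (lookup-map w ∣_∣ κ)) (∣p∣≤n (lookup κ w))))
  typeOf≡ : ∀ {α κ} → HasType G α κ → typeOf κ ≡ α
  typeOf≡ {κ = κ} type = lookup-ext λ w → trans (lookup-map w ∣_∣ κ) (type w)

Y-card : (G : Graph) (a : Vec ℕ k) → Card (ProperWith G a) (coeff (Y G) a)
Y-card G a = card-⇔ proj₁ (_, tt) (∑X-card G U? a)

noColors : Coloring single k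
noColors = ⊥ ∷ []

content-noColors : content single (noColors {k}) ≡ replicate k 0
content-noColors {k} = lookup-ext λ i → begin
  lookup (content single (noColors {k})) i  ≡⟨ lookup∘tabulate _ i ⟩
  count (i ∈?_) (noColors {k})              ≡⟨ uncolored i ⟩
  0                                         ≡⟨ lookup-replicate i 0 ⟨
  lookup (replicate k 0) i                  ∎
  where
  open ≡-Reasoning
  uncolored : ∀ i → count (i ∈?_) (noColors {k}) ≡ 0
  uncolored i with i ∈? ⊥ {k}
  ... | yes i∈ = contradiction i∈ ∉⊥
  ... | no _   = refl

-- The series 1 is represented by the empty coloring of the one-vertex graph, whose monomial is 1,
-- so that it can be removed from the colorings counted by `Y single`.
𝟙-card : (b : Vec ℕ k) → Card (λ σ → σ ≡ noColors × content single σ ≡ b) (coeff 𝟙 b)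
𝟙-card b with ≡-dec ℕ._≟_ b (replicate _ 0)
... | yes b≡0 = card-singleton noColors (refl , trans content-noColors (sym b≡0)) proj₁
... | no b≢0  = card-⊥ λ { (refl , eq) → b≢0 (trans (sym eq) content-noColors) }

-- Properness disappears from the predicate because a single vertex has no edges.
Y-single⊖𝟙-card : (b : Vec ℕ k) →
  Card (λ σ → σ ≢ noColors × content single σ ≡ b) (coeff (Y single ⊖ 𝟙) b)
Y-single⊖𝟙-card b = card-⇔
  (λ ((_ , eq) , ¬none) → (λ none → ¬none (none , eq)) , eq)
  (λ (¬none , eq) → ((λ _ _ ()) , eq) , ¬none ∘ proj₁)
  (card-∖ (λ σ → ≡-dec (≡-dec Bool._≟_) σ noColors ×-dec ≡-dec ℕ._≟_ (content single σ) b)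
          (λ (_ , eq) → (λ _ _ ()) , eq) (Y-card single b) (𝟙-card b))

-- Restricting colorings to an induced subgraph and extending them back.

lookup-injective : {xs : List A} → Unique xs → ∀ {i j} → List.lookup xs i ≡ List.lookup xs j → i ≡ j
lookup-injective (_  ∷ _) {zero}  {zero}  _  = refl
lookup-injective (x∉ ∷ _) {zero}  {suc j} eq = contradiction eq (All.lookup x∉ (∈-lookup j))
lookup-injective (x∉ ∷ _) {suc i} {zero}  eq = contradiction (sym eq) (All.lookup x∉ (∈-lookup i))
lookup-injective (_  ∷ u) {suc i} {suc j} eq = cong suc (lookup-injective u eq)

module Induced (G : Graph) (S : Subset (order G)) where

  H : Graph
  H = G ∖ S

  vertex : Vertex H → Vertex G
  vertex = List.lookup (kept G S)

  vertex∉S : ∀ i → vertex i ∉ S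
  vertex∉S i = proj₂ (∈-filter⁻ (λ u → ¬? (u ∈? S)) {xs = List.allFin _}
                              (∈-lookup {xs = kept G S} i))

  ∈-kept : ∀ {u} → u ∉ S → u ∈ˡ kept G S
  ∈-kept {u} = ∈-filter⁺ (λ u → ¬? (u ∈? S)) (∈-allFin u)

  position : ∀ {u} → u ∉ S → Vertex H
  position u∉ = Any.index (∈-kept u∉)

  vertex-position : ∀ {u} (u∉ : u ∉ S) → vertex (position u∉) ≡ u
  vertex-position u∉ = sym (lookup-index (∈-kept u∉))

  vertex-injective : ∀ {i j} → vertex i ≡ vertex j → i ≡ j
  vertex-injective = lookup-injective (filter⁺ (λ u → ¬? (u ∈? S)) (allFin⁺ (order G)))

  module _ {k : ℕ} where

    restrict : Coloring G k → Coloring H k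
    restrict κ = tabulate (lookup κ ∘ vertex)

    glue : (Vertex G → Subset k) → Coloring H k → Vertex G → Subset k
    glue d κ u with u ∈? S
    ... | yes _  = d u
    ... | no  u∉ = lookup κ (position u∉)

    extend : (Vertex G → Subset k) → Coloring H k → Coloring G k
    extend d κ = tabulate (glue d κ)

    lookup-restrict : ∀ κ i → lookup (restrict κ) i ≡ lookup κ (vertex i)
    lookup-restrict κ = lookup∘tabulate (lookup κ ∘ vertex)

    lookup-extend-∈ : ∀ d κ {u} → u ∈ S → lookup (extend d κ) u ≡ d u
    lookup-extend-∈ d κ {u} u∈ = trans (lookup∘tabulate (glue d κ) u) glue-∈
      where
      glue-∈ : glue d κ u ≡ d u
      glue-∈ with u ∈? S
      ... | yes _  = refl
      ... | no  u∉ = contradiction u∈ u∉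

    lookup-extend-vertex : ∀ d κ i → lookup (extend d κ) (vertex i) ≡ lookup κ i
    lookup-extend-vertex d κ i = trans (lookup∘tabulate (glue d κ) (vertex i)) glue-vertex
      where
      glue-vertex : glue d κ (vertex i) ≡ lookup κ i
      glue-vertex with vertex i ∈? S
      ... | yes i∈ = contradiction i∈ (vertex∉S i)
      -- `position i∉` is found by searching for `vertex i` in `kept G S`; it is `i` again because
      -- that list has no repetitions.
      ... | no  i∉ = cong (lookup κ) (vertex-injective (vertex-position i∉))

    restrict-extend : ∀ d κ → restrict (extend d κ) ≡ κ
    restrict-extend d κ = lookup-ext λ i →
      trans (lookup-restrict (extend d κ) i) (lookup-extend-vertex d κ i)

    extend-restrict : ∀ d κ → (∀ {u} → u ∈ S → d u ≡ lookup κ u) → extend d (restrict κ) ≡ κ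
    extend-restrict d κ eq = lookup-ext λ u →
      trans (lookup∘tabulate (glue d (restrict κ)) u) (glued u)
      where
      glued : ∀ u → glue d (restrict κ) u ≡ lookup κ u
      glued u with u ∈? S
      ... | yes u∈ = eq u∈
      ... | no  u∉ = trans (lookup-restrict κ (position u∉)) (cong (lookup κ) (vertex-position u∉))

    restrict-proper : ∀ κ → Proper G κ → Proper H (restrict κ)
    restrict-proper κ proper i j adj =
      subst₂ (λ s t → Empty (s ∩ t)) (sym (lookup-restrict κ i)) (sym (lookup-restrict κ j))
        (proper (vertex i) (vertex j) adj)

    lookup-restrict-position : ∀ κ {u} (u∉ : u ∉ S) →
                               lookup (restrict κ) (position u∉) ≡ lookup κ u
    lookup-restrict-position κ u∉ =
      trans (lookup-restrict κ (position u∉)) (cong (lookup κ) (vertex-position u∉))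

    module _ {v : Vertex G} (v∈S : v ∈ S) where

      -- This treats the deletions of `⁅ v ⁆` and of `N[ G , v ]` together. For the first the
      -- condition is vacuous; for the second it says that the neighbors of `v` are uncolored.
      EmptyElsewhere : Pred (Coloring G k) 0ℓ
      EmptyElsewhere κ = ∀ {u} → u ∈ S → u ≢ v → lookup κ u ≡ ⊥

      colored : ∀ κ → EmptyElsewhere κ → ∀ {u i} → i ∈ lookup κ u → u ≡ v ⊎ u ∉ S
      colored κ empty {u} {i} i∈ with u ∈? S | u Fin.≟ v
      ... | no  u∉ | _       = inj₂ u∉
      ... | yes _  | yes u≡v = inj₁ u≡v
      ... | yes u∈ | no  u≢v = contradiction (subst (i ∈_) (empty u∈ u≢v) i∈) ∉⊥

      -- The two alternatives are the two deletions: either `v` carries no color, or all neighbors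
      -- of `v` are deleted along with it. In both, an edge from a colored `v` cannot leave `S`.
      no-edge : ∀ {s : Subset k} {i u} → s ≡ ⊥ ⊎ (∀ {u} → Adj G v u → u ∈ S) →
                i ∈ s → Adj G v u → ¬ u ∉ S
      no-edge (inj₁ refl)   i∈ _   _  = ∉⊥ i∈
      no-edge (inj₂ within) _  adj u∉ = u∉ (within adj)

      -- A color shared by the ends of an edge puts each end at `v` or outside `S`. Two ends at `v`
      -- would form a loop, one end at `v` is excluded by `no-edge`, and two ends outside `S`
      -- contradict properness on `H`.
      restrict-proper⁻ : ∀ κ → EmptyElsewhere κ →
                         lookup κ v ≡ ⊥ ⊎ (∀ {u} → Adj G v u → u ∈ S) →
                         Proper H (restrict κ) → Proper G κ
      restrict-proper⁻ κ empty isolated proper w w′ adj (i , i∈∩)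
        with i∈w , i∈w′ ← x∈p∩q⁻ (lookup κ w) (lookup κ w′) i∈∩
        with colored κ empty i∈w | colored κ empty i∈w′
      ... | inj₁ refl | inj₁ refl = irrefl G refl adj
      ... | inj₁ refl | inj₂ w′∉  = no-edge isolated i∈w adj w′∉
      ... | inj₂ w∉   | inj₁ refl = no-edge isolated i∈w′ (symm G adj) w∉
      ... | inj₂ w∉   | inj₂ w′∉  =
        proper (position w∉) (position w′∉)
          (subst₂ (Adj G) (sym (vertex-position w∉)) (sym (vertex-position w′∉)) adj)
          (i , x∈p∩q⁺ ( subst (i ∈_) (sym (lookup-restrict-position κ w∉)) i∈w
                      , subst (i ∈_) (sym (lookup-restrict-position κ w′∉)) i∈w′))

      -- The vertices carrying a color `i` are `v`, if it carries `i`, and vertices outside `S`; the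
      -- latter correspond to vertices of `H` through `vertex`.
      content-split : ∀ κ → EmptyElsewhere κ →
        content G κ ≡ zipWith _+_ (content single (lookup κ v ∷ [])) (content H (restrict κ))
      content-split κ empty = lookup-ext λ i → begin
        lookup (content G κ) i               ≡⟨ lookup∘tabulate _ i ⟩
        count (i ∈?_) κ
          ≡⟨ ℤ.+-injective (card-unique (card-count (i ∈?_) κ) (split i)) ⟩
        count (i ∈?_) (lookup κ v ∷ []) + count (i ∈?_) (restrict κ)
          ≡⟨ cong₂ _+_ (lookup∘tabulate _ i) (lookup∘tabulate _ i) ⟨
        lookup (content single (lookup κ v ∷ [])) i + lookup (content H (restrict κ)) i
          ≡⟨ lookup-zipWith _+_ i (content single (lookup κ v ∷ [])) (content H (restrict κ)) ⟨
        lookup (zipWith _+_ (content single (lookup κ v ∷ [])) (content H (restrict κ))) i ∎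
        where
        open ≡-Reasoning
        split : ∀ i → Card (λ u → i ∈ lookup κ u)
                  (+ count (i ∈?_) (lookup κ v ∷ []) ℤ.+ + count (i ∈?_) (restrict κ))
        split i = card-⊎ {P = λ u → u ≡ v × i ∈ lookup κ u} {Q = λ u → u ∉ S × i ∈ lookup κ u}
          proj₂ proj₂
          (λ i∈ → Sum.map (_, i∈) (_, i∈) (colored κ empty i∈))
          (λ { (refl , _) (v∉ , _) → v∉ v∈S })
          (card-map (λ _ → v) (λ _ → zero)
            (λ { {zero} i∈ → refl , i∈ ; {suc ()} }) (λ { (refl , i∈) → i∈ })
            (λ { {zero} _ → refl ; {suc ()} }) (λ { (refl , _) → refl })
            (card-count (i ∈?_) (lookup κ v ∷ [])))
          (card-image vertex
            (λ {j} i∈ → vertex∉S j , subst (i ∈_) (lookup-restrict κ j) i∈)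
            (λ (u∉ , i∈) → position u∉
                         , subst (i ∈_) (sym (lookup-restrict-position κ u∉)) i∈
                         , vertex-position u∉)
            (λ _ _ → vertex-injective) (card-count (i ∈?_) (restrict κ)))

      onlyAt : Subset k → Vertex G → Subset k
      onlyAt s u with u Fin.≟ v
      ... | yes _ = s
      ... | no  _ = ⊥

      onlyAt-at : ∀ s → onlyAt s v ≡ s
      onlyAt-at s with v Fin.≟ v
      ... | yes _   = refl
      ... | no  v≢v = contradiction refl v≢v

      onlyAt-elsewhere : ∀ s {u} → u ≢ v → onlyAt s u ≡ ⊥
      onlyAt-elsewhere s {u} u≢v with u Fin.≟ v
      ... | yes u≡v = contradiction u≡v u≢v
      ... | no  _   = refl

      lookup-extend-at : ∀ s κ → lookup (extend (onlyAt s) κ) v ≡ s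
      lookup-extend-at s κ = trans (lookup-extend-∈ (onlyAt s) κ v∈S) (onlyAt-at s)

      extend-empty : ∀ s κ → EmptyElsewhere (extend (onlyAt s) κ)
      extend-empty s κ u∈ u≢v = trans (lookup-extend-∈ (onlyAt s) κ u∈) (onlyAt-elsewhere s u≢v)

      extend-content : ∀ s κ → content G (extend (onlyAt s) κ)
                             ≡ zipWith _+_ (content single (s ∷ [])) (content H κ)
      extend-content s κ = trans (content-split (extend (onlyAt s) κ) (extend-empty s κ))
        (cong₂ (λ t κ′ → zipWith _+_ (content single (t ∷ [])) (content H κ′))
          (lookup-extend-at s κ) (restrict-extend (onlyAt s) κ))

      extend-proper : ∀ s κ → s ≡ ⊥ ⊎ (∀ {u} → Adj G v u → u ∈ S) →
                      Proper H κ → Proper G (extend (onlyAt s) κ)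
      extend-proper s κ isolated proper =
        restrict-proper⁻ (extend (onlyAt s) κ) (extend-empty s κ)
          ([ inj₁ ∘ trans (lookup-extend-at s κ) , inj₂ ]′ isolated)
          (subst (Proper H) (sym (restrict-extend (onlyAt s) κ)) proper)

      -- On `S` the only information in `κ` is its set at `v`. Together with `restrict-extend` and
      -- `lookup-extend-at` this makes restriction and extension mutually inverse.
      extend-onlyAt-restrict : ∀ κ → EmptyElsewhere κ →
                             extend (onlyAt (lookup κ v)) (restrict κ) ≡ κ
      extend-onlyAt-restrict κ empty = extend-restrict _ κ agree
        where
        agree : ∀ {u} → u ∈ S → onlyAt (lookup κ v) u ≡ lookup κ u
        agree {u} u∈ with u Fin.≟ v
        ... | yes refl = refl
        ... | no  u≢v  = sym (empty u∈ u≢v)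

-- The three classes of colorings and their counts.

∣p∣≡0⇒p≡⊥ : (p : Subset n) → ∣ p ∣ ≡ 0 → p ≡ ⊥
∣p∣≡0⇒p≡⊥ []            _  = refl
∣p∣≡0⇒p≡⊥ (outside ∷ p) eq = cong (outside ∷_) (∣p∣≡0⇒p≡⊥ p eq)

typeOf-positive⁺ : (κ : Vec (Subset k) n) {u : Fin n} → lookup κ u ≢ ⊥ → 1 ≤ lookup (typeOf κ) u
typeOf-positive⁺ κ {u} ≢⊥ = subst (1 ≤_) (sym (lookup-map u ∣_∣ κ))
  (ℕ.n≢0⇒n>0 (≢⊥ ∘ ∣p∣≡0⇒p≡⊥ (lookup κ u)))

typeOf-positive⁻ : (κ : Vec (Subset k) n) {u : Fin n} → 1 ≤ lookup (typeOf κ) u → lookup κ u ≢ ⊥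
typeOf-positive⁻ {k = k} κ {u} pos ≡⊥ =
  ℕ.n≮0 (subst (1 ≤_) (trans (lookup-map u ∣_∣ κ) (trans (cong ∣_∣ ≡⊥) (∣⊥∣≡0 k))) pos)

module _ (G : Graph) (v : Vertex G) where

  Adj⇒∈N : ∀ {u} → Adj G v u → u ∈ N G v
  Adj⇒∈N {u} adj = lookup⇒[]= u (N G v) (trans (lookup∘tabulate _ u) (dec-true (adj? G v u) adj))

  ∈N⇒≢ : ∀ {u} → u ∈ N G v → u ≢ v
  -- Membership in `N G v` is the equation `does (adj? G v v) ≡ true`; abstracting both makes the
  -- `no` case an absurd `false ≡ true`.
  ∈N⇒≢ u∈N refl with adj? G v v
    | trans (sym (lookup∘tabulate (λ u → does (adj? G v u)) v)) ([]=⇒lookup u∈N)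
  ... | yes adj | _ = irrefl G refl adj

  Uncolored : Pred (Coloring G k) 0ℓ
  Uncolored κ = lookup κ v ≡ ⊥

  Isolated : Pred (Coloring G k) 0ℓ
  Isolated κ = lookup κ v ≢ ⊥ × (∀ {u} → u ∈ N G v → lookup κ u ≡ ⊥)

  -- The bijection puts the empty set at `v`. This creates no conflict along edges and adds zero to
  -- the content.
  uncolored-card : (a : Vec ℕ k) →
    Card (λ κ → ProperWith G a κ × Uncolored κ) (coeff (Y (G ∖ ⁅ v ⁆)) a)
  uncolored-card a = card-map
    (extend (onlyAt v∈ ⊥)) restrict
    (λ {κ} (proper , eq) →
      ( extend-proper v∈ ⊥ κ (inj₁ refl) proper
      , trans (extend-content v∈ ⊥ κ) (trans (only κ) eq))
      , lookup-extend-at v∈ ⊥ κ)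
    (λ {κ} ((proper , eq) , ≡⊥) → restrict-proper κ proper ,
      (begin
        content H (restrict κ)  ≡⟨ only (restrict κ) ⟨
        zipWith _+_ (content single noColors) (content H (restrict κ))
          ≡⟨ cong (λ s → zipWith _+_ (content single (s ∷ [])) (content H (restrict κ))) ≡⊥ ⟨
        zipWith _+_ (content single (lookup κ v ∷ [])) (content H (restrict κ))
          ≡⟨ content-split v∈ κ empty ⟨
        content G κ             ≡⟨ eq ⟩
        a                       ∎))
    (λ {κ} _ → restrict-extend (onlyAt v∈ ⊥) κ)
    (λ {κ} (_ , ≡⊥) → trans (cong (λ s → extend (onlyAt v∈ s) (restrict κ)) (sym ≡⊥))
                            (extend-onlyAt-restrict v∈ κ empty))
    (Y-card (G ∖ ⁅ v ⁆) a)
    where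
    open Induced G ⁅ v ⁆
    open ≡-Reasoning
    v∈ = x∈⁅x⁆ v
    -- The hypotheses contradict each other, so the conclusion is left arbitrary and fits
    -- `EmptyElsewhere` for every coloring.
    empty : ∀ {A : Set} {u} → u ∈ ⁅ v ⁆ → u ≢ v → A
    empty u∈ u≢v = contradiction (x∈⁅y⁆⇒x≡y v u∈) u≢v
    only : ∀ κ → zipWith _+_ (content single noColors) (content H κ) ≡ content H κ
    only κ = trans (cong (λ b → zipWith _+_ b (content H κ)) content-noColors)
                   (zipWith-identityˡ (λ _ → refl) (content H κ))

  -- All neighbors of `v` are deleted and then left empty, so the nonempty set at `v` can be chosen
  -- independently of the coloring of the rest. This independence is the product of the two series.
  isolated-card : (a : Vec ℕ k) →
    Card (λ κ → ProperWith G a κ × Isolated κ) (coeff ((Y single ⊖ 𝟙) ⊛ Y (G ∖ N[ G , v ])) a)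
  isolated-card {k} a = card-map
    (λ (σ , κ) → extend (onlyAt v∈ (Vec.head σ)) κ) (λ κ → (lookup κ v ∷ []) , restrict κ)
    (λ { {s ∷ [] , κ} ((s≢⊥ , proper) , eq) →
      ( extend-proper v∈ s κ (inj₂ (N⊆ ∘ Adj⇒∈N)) proper , trans (extend-content v∈ s κ) eq)
      , (λ ≡⊥ → s≢⊥ (cong (_∷ []) (trans (sym (lookup-extend-at v∈ s κ)) ≡⊥)))
      , λ u∈N → extend-empty v∈ s κ (N⊆ u∈N) (∈N⇒≢ u∈N) })
    (λ {κ} ((proper , eq) , ≢⊥ , alone) →
      ((λ ≡noColors → ≢⊥ (∷-injectiveˡ ≡noColors)) , restrict-proper κ proper)
      , trans (sym (content-split v∈ κ (empty κ alone))) eq)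
    (λ { {s ∷ [] , κ} _ →
      cong₂ _,_ (cong (_∷ []) (lookup-extend-at v∈ s κ)) (restrict-extend _ κ) })
    (λ {κ} (_ , _ , alone) → extend-onlyAt-restrict v∈ κ (empty κ alone))
    (card-⊛ {f = Y single ⊖ 𝟙} {g = Y H} (content single) (content H) Y-single⊖𝟙-card (Y-card H))
    where
    open Induced G N[ G , v ]
    v∈ : v ∈ N[ G , v ]
    v∈ = x∈p∪q⁺ (inj₁ (x∈⁅x⁆ v))
    N⊆ : ∀ {u} → u ∈ N G v → u ∈ N[ G , v ]
    N⊆ = x∈p∪q⁺ ∘ inj₂
    empty : ∀ κ → (∀ {u} → u ∈ N G v → lookup κ u ≡ ⊥) → EmptyElsewhere {k = k} v∈ κ
    empty κ alone u∈ u≢v =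
      [ (λ u∈⁅v⁆ → contradiction (x∈⁅y⁆⇒x≡y v u∈⁅v⁆) u≢v) , alone ]′ (x∈p∪q⁻ ⁅ v ⁆ (N G v) u∈)

  trichotomy : (κ : Coloring G k) → (Uncolored κ ⊎ Isolated κ) ⊎ PositiveAtAndNear G v (typeOf κ)
  trichotomy κ with ≡-dec Bool._≟_ (lookup κ v) ⊥ | positiveAtAndNear? G v (typeOf κ)
  ... | _      | yes pos = inj₂ pos
  ... | yes ≡⊥ | no _    = inj₁ (inj₁ ≡⊥)
  ... | no ≢⊥  | no ¬pos = inj₁ (inj₂ (≢⊥ , λ {u} u∈N →
    -- Failure of `PositiveAtAndNear` only refutes that `u` is colored; decidable equality of
    -- subsets turns this into emptiness.
    decidable-stable (≡-dec Bool._≟_ (lookup κ u) ⊥)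
      λ u≢⊥ → ¬pos (typeOf-positive⁺ κ ≢⊥ , u , u∈N , typeOf-positive⁺ κ u≢⊥)))

proposition3p3 : (G : Graph) (v : Vertex G) →
    Y G ≈ Y (G ∖ ⁅ v ⁆)
    ⊕ (Y single ⊖ 𝟙) ⊛ Y (G ∖ N[ G , v ])
    ⊕ (∑[ positiveAtAndNear? G v ] X G by X-summable G)
-- Both sides count the proper colorings of `G` with content `a`, the right side class by class.
proposition3p3 G v a = card-unique (Y-card G a)
  (card-⊎ [ proj₁ , proj₁ ]′ proj₁
    (λ {κ} pw → Sum.map (Sum.map (pw ,_) (pw ,_)) (pw ,_) (trichotomy G v κ))
    -- The third class is disjoint from the first because of the set at `v`, and from the second
    -- because of the set at the colored neighbor `u`.
    (λ { {κ} (inj₁ (_ , ≡⊥)) (_ , pos , _) → typeOf-positive⁻ κ pos ≡⊥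
       ; {κ} (inj₂ (_ , _ , alone)) (_ , _ , u , u∈N , pos) → typeOf-positive⁻ κ pos (alone u∈N) })
    (card-⊎ inj₁ inj₂ id (λ (_ , ≡⊥) (_ , ≢⊥ , _) → ≢⊥ ≡⊥)
      (uncolored-card G v a) (isolated-card G v a))
    (∑X-card G (positiveAtAndNear? G v) a))
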